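{- Let $k$ and $m$ be positive integers. Then $\max\{k+1,2m-1\}$ is the sharp minimum degree threshold guaranteeing a $k$-removable matching of size $m$ without exceptions; that is, $d=\max\{k+1,2m-1\}$ is the smallest integer $d$ such that every $k$-connected graph $G$ with $\delta(G)\ge d$ contains a $k$-removable matching of size $m$.
   Context: All graphs are finite, undirected and simple. $\delta(G)$ is the minimum degree of $G$. A graph is $k$-connected in the usual sense: it has more than $k$ vertices and deleting any set of fewer than $k$ vertices leaves a connected graph. For a $k$-connected graph $G$, a matching $M\subseteq E(G)$ (a set of pairwise vertex-disjoint edges) is called $k$-removable if the graph $G-M$, obtained from $G$ by deleting the edges in $M$ (keeping all vertices), is $k$-connected. The size of a matching is its number of edges. -}

module Defs where

open import Data.Fin.Base using (Fin)
open import Data.Fin.Properties using (_≟_)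
open import Data.Fin.Subset using (Subset; ∣_∣; _∉_)
open import Data.Integer.Base as ℤ using (ℤ; +_)
open import Data.List.Base using (List; length; map; allFin)
open import Data.List.Extrema.Nat using (min)
import Data.List.Membership.DecPropositional as DecMembership
import Data.List.Membership.Propositional as L
open import Data.List.Relation.Unary.All using (All)
open import Data.List.Relation.Unary.AllPairs using (AllPairs)
open import Data.Nat.Base using (ℕ; _<_)
open import Data.Product.Base using (Σ-syntax; _×_; _,_; proj₁)
open import Data.Product.Properties using (≡-dec)
open import Data.Vec.Base using (tabulate)
open import Level using (0ℓ)
open import Relation.Binary.Core using (Rel)
open import Relation.Binary.Construct.Closure.ReflexiveTransitive using (Star)
open import Relation.Binary.Definitions using (Decidable; Symmetric; Irreflexive)
open import Relation.Binary.PropositionalEquality.Core using (_≡_; _≢_; cong)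
open import Relation.Nullary.Decidable using (does; ¬?; _×-dec_)

record Graph (V : Set) : Set₁ where
  field
    Adj    : Rel V 0ℓ
    adj?   : Decidable Adj
    sym    : Symmetric Adj
    irrefl : Irreflexive _≡_ Adj

open Graph public

-- Finite graphs are taken on the vertex set Fin n.
FinGraph : ℕ → Set₁
FinGraph n = Graph (Fin n)

neighbours : ∀ {n} → FinGraph n → Fin n → Subset n
neighbours G v = tabulate (λ w → does (adj? G v w))

degree : ∀ {n} → FinGraph n → Fin n → ℕ
degree G v = ∣ neighbours G v ∣

-- The first argument of min is only a cap on the result.  Every degree is
-- less than n, so the cap n is inactive unless n is 0, where δ G is 0.
δ : ∀ {n} → FinGraph n → ℕ
δ {n} G = min n (map (degree G) (allFin n))

Connected : ∀ {V} → Graph V → Set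
Connected G = ∀ u v → Star (Adj G) u v

deleteVertices : ∀ {n} → FinGraph n → (S : Subset n) → Graph (Σ[ v ∈ Fin n ] v ∉ S)
deleteVertices G S = record
  { Adj    = λ u v → Adj G (proj₁ u) (proj₁ v)
  ; adj?   = λ u v → adj? G (proj₁ u) (proj₁ v)
  ; sym    = sym G
  ; irrefl = λ u≡v → irrefl G (cong proj₁ u≡v)
  }

-- Deleting fewer than k of more than k vertices leaves a vertex, so it does
-- not matter that Connected also holds of the graph without vertices.
KConnected : ∀ {n} → ℕ → FinGraph n → Set
KConnected {n} k G = k < n × (∀ (S : Subset n) → ∣ S ∣ < k → Connected (deleteVertices G S))

VertexDisjoint : ∀ {n} → Rel (Fin n × Fin n) 0ℓ
VertexDisjoint (a , b) (c , d) = a ≢ c × a ≢ d × b ≢ c × b ≢ d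

-- Each edge is listed once, by an ordered pair of its ends in either order;
-- disjointness excludes repetitions, so length counts the edges.
record Matching {n} (G : FinGraph n) : Set where
  field
    edges    : List (Fin n × Fin n)
    inGraph  : All (λ (u , v) → Adj G u v) edges
    disjoint : AllPairs VertexDisjoint edges

  size : ℕ
  size = length edges

open Matching public

deleteMatching : ∀ {n} (G : FinGraph n) → Matching G → FinGraph n
deleteMatching G M = record
  { Adj    = λ u v → Adj G u v × (u , v) L.∉ edges M × (v , u) L.∉ edges M
  ; adj?   = λ u v → adj? G u v ×-dec ¬? ((u , v) ∈? edges M) ×-dec ¬? ((v , u) ∈? edges M)
  ; sym    = λ (a , p , q) → sym G a , q , p
  ; irrefl = λ u≡v (a , _) → irrefl G u≡v a
  }
  where open DecMembership (≡-dec _≟_ _≟_) using (_∈?_)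

Removable : ∀ {n} → ℕ → (G : FinGraph n) → Matching G → Set
Removable k G M = KConnected k (deleteMatching G M)

Guarantees : ℕ → ℕ → ℤ → Set₁
Guarantees k m d =
  ∀ {n} (G : FinGraph n) → KConnected k G → d ℤ.≤ + δ G →
  Σ[ M ∈ Matching G ] (Removable k G M × size M ≡ m)

IsLeast : ∀ {ℓ} → (ℤ → Set ℓ) → ℤ → Set ℓ
IsLeast P d = P d × (∀ d′ → P d′ → d ℤ.≤ d′)

{-# OPTIONS --safe #-}
-- Upper bound.  Let M be a removable matching with s < m edges, H = G - M, and suppose
-- that no edge of H between uncovered vertices can be added to M.  Then each such edge xy
-- has a separation (L, S, R): |S| < k, x in L, y in R, and xy is the only edge of H from
-- L to R.  Crossing the separations of xy and of yw, where w ≠ x, shows that |R| is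
-- strictly smaller for yw, because y has degree above k (this contains Mader's theorem
-- that a cycle of critical edges has a vertex of degree k).  A walk along uncovered
-- vertices therefore ends at an uncovered y whose only uncovered neighbour is x.  As y
-- has degree above 2s, it is adjacent to all covered vertices, so L contains none of
-- them.  Every vertex of L has more than k neighbours, fewer than k of them in S, so a
-- walk entering L along yx can be continued inside L without turning back; it shrinks
-- |R| at each step, and closing up would contradict this.
--
-- Lower bound.  The complete graph on max(k + 1, 2m - 1) vertices has minimum degree one
-- less than that.  Deleting any edge of the one on k + 1 vertices destroys k-connectedness,
-- and the one on 2m - 1 vertices is too small for a matching of size m.
module Submission where

import Algebra.Properties.CommutativeMonoid.Sum
open import Data.Bool.Base using (Bool; true; false; not; _∧_; _∨_)
open import Data.Bool.Properties using (∨-zeroʳ; ∨-identityʳ; ∧-zeroʳ)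
open import Data.Empty using (⊥; ⊥-elim)
open import Data.Fin.Base using (Fin; zero; suc; opposite)
open import Data.Fin.Properties using (_≟_; any?; all?)
open import Data.Fin.Subset using (Subset; ∣_∣; _∈_; _∉_; _⊃_; _∪_; ⁅_⁆)
open import Data.Fin.Subset.Induction using (⊃-wellFounded)
open import Data.Fin.Subset.Properties using (_∈?_; x∈⁅x⁆; x∈⁅y⁆⇒x≡y; p⊆p∪q; x∈p∪q⁺; x∈p∪q⁻)
open import Data.Integer.Base as ℤ using (+_; +≤+)
import Data.Integer.Properties as ℤP
open import Data.List.Base using (List; []; _∷_; length; map; allFin)
open import Data.List.Extrema.Nat using (min≤xs; v≤min⁺)
import Data.List.Membership.DecPropositional as DecMembership
import Data.List.Membership.Propositional as L
open import Data.List.Membership.Propositional.Properties using (∈-map⁺; ∈-allFin)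
open import Data.List.Relation.Unary.All as All using (All; []; _∷_)
import Data.List.Relation.Unary.All.Properties as AllP
open import Data.List.Relation.Unary.AllPairs using (AllPairs; []; _∷_)
open import Data.List.Relation.Unary.Any using (here; there)
open import Data.Nat.Base using (ℕ; zero; suc; _+_; _*_; _∸_; _⊔_; _≥_; _≤_; _<_; z≤n; s≤s; s≤s⁻¹)
open import Data.Nat.Induction using (<-wellFounded)
open import Data.Nat.Properties renaming (_≟_ to _≟ℕ_)
open import Data.Product.Base using (Σ; ∃; _×_; _,_; proj₁; proj₂)
open import Data.Sum.Base as Sum using (_⊎_; inj₁; inj₂)
open import Data.Vec.Base using (Vec; []; _∷_; lookup; tabulate)
open import Data.Vec.Properties using (lookup∘tabulate; lookup⇒[]=; []=⇒lookup)
open import Function.Base using (_∘_)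
open import Induction.WellFounded using (Acc; acc)
open import Relation.Binary.Construct.Closure.ReflexiveTransitive as Star using (Star; ε; _◅_; _◅◅_)
open import Relation.Binary.PropositionalEquality using (_≡_; _≢_; refl; sym; trans; cong; cong₂; subst; subst₂; ≢-sym)
open import Relation.Nullary.Decidable using (Dec; yes; no; does; _×-dec_; _→-dec_; ¬?; map′; dec-true; decidable-stable)
open import Relation.Nullary.Negation using (¬_; contradiction)
open import Defs hiding (sym)
import Defs as D

open Algebra.Properties.CommutativeMonoid.Sum +-0-commutativeMonoid
  using (sum; sum-cong-≗; ∑-distrib-+; sum-replicate-zero)
open module DecFin {n} = DecMembership (_≟_ {n}) using () renaming (_∈?_ to _∈L?_)

private
  variable
    n k : ℕ

-- Counting

sum-mono : {f g : Fin n → ℕ} → (∀ i → f i ≤ g i) → sum f ≤ sum g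
sum-mono {zero}  f≤g = z≤n
sum-mono {suc n} f≤g = +-mono-≤ (f≤g zero) (sum-mono (f≤g ∘ suc))

sum-mono₂ : (f g f′ g′ : Fin n → ℕ) → (∀ i → f i + g i ≤ f′ i + g′ i) →
            sum f + sum g ≤ sum f′ + sum g′
sum-mono₂ f g f′ g′ le =
  subst₂ _≤_ (∑-distrib-+ f g) (∑-distrib-+ f′ g′) (sum-mono le)

sum-ones : ∀ n → sum {n} (λ _ → 1) ≡ n
sum-ones zero    = refl
sum-ones (suc n) = cong suc (sum-ones n)

χ : Bool → ℕ
χ true  = 1
χ false = 0

# : (Fin n → Bool) → ℕ
# p = sum (χ ∘ p)

at : Fin n → Fin n → ℕ
at x i = χ (does (i ≟ x))

sum-at : (x : Fin n) → sum (at x) ≡ 1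
sum-at {suc n} zero    = cong suc (sum-replicate-zero n)
sum-at         (suc x) = sum-at x

at-self : (x : Fin n) → at x x ≡ 1
at-self x = cong χ (dec-true (x ≟ x) refl)

at-≢ : {x i : Fin n} → i ≢ x → at x i ≡ 0
at-≢ {x = x} {i} i≢x with i ≟ x
... | yes i≡x = contradiction i≡x i≢x
... | no  _   = refl

χ-positive : ∀ {b} → b ≡ true → 1 ≤ χ b
χ-positive refl = ≤-refl

∣∣≡# : (S : Subset n) → ∣ S ∣ ≡ # (lookup S)
∣∣≡# []          = refl
∣∣≡# (true  ∷ S) = cong suc (∣∣≡# S)
∣∣≡# (false ∷ S) = ∣∣≡# S

∣tabulate∣ : (p : Fin n → Bool) → ∣ tabulate p ∣ ≡ # p
∣tabulate∣ p = trans (∣∣≡# (tabulate p)) (sum-cong-≗ (cong χ ∘ lookup∘tabulate p))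

∉-tabulate⁺ : {p : Fin n → Bool} {i : Fin n} → p i ≡ false → i ∉ tabulate p
∉-tabulate⁺ {p = p} {i} pi i∈ with trans (sym pi) (trans (sym (lookup∘tabulate p i)) ([]=⇒lookup i∈))
... | ()

∉-tabulate⁻ : {p : Fin n → Bool} {i : Fin n} → i ∉ tabulate p → p i ≢ true
∉-tabulate⁻ {p = p} {i} i∉ pi = i∉ (lookup⇒[]= i _ (trans (lookup∘tabulate p i) pi))

degree≡# : (G : FinGraph n) (v : Fin n) → degree G v ≡ # (does ∘ adj? G v)
degree≡# G v = ∣tabulate∣ (does ∘ adj? G v)

degree-≤-sum : (G : FinGraph n) (v : Fin n) (f : Fin n → ℕ) →
               (∀ i → Adj G v i → 1 ≤ f i) → degree G v ≤ sum f
degree-≤-sum G v f covers = ≤-trans (≤-reflexive (degree≡# G v)) (sum-mono pointwise)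
  where
  pointwise : ∀ i → χ (does (adj? G v i)) ≤ f i
  pointwise i with adj? G v i
  ... | yes a = covers i a
  ... | no  _ = z≤n

degree-<-sum : (G : FinGraph n) (v w : Fin n) (f : Fin n → ℕ) → ¬ Adj G v w → 1 ≤ f w →
               (∀ i → Adj G v i → 1 ≤ f i) → degree G v < sum f
degree-<-sum G v w f ¬vw fw covers =
  subst₂ _≤_ (trans (∑-distrib-+ (at w) _) (cong₂ _+_ (sum-at w) (sym (degree≡# G v)))) refl
    (sum-mono {f = λ i → at w i + χ (does (adj? G v i))} pointwise)
  where
  pointwise : ∀ i → at w i + χ (does (adj? G v i)) ≤ f i
  pointwise i with i ≟ w | adj? G v i
  ... | yes refl | yes a = contradiction a ¬vw
  ... | yes refl | no  _ = fw
  ... | no  _    | yes a = covers i a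
  ... | no  _    | no  _ = z≤n

-- Cuts

-- A walk avoiding `T` cannot leave `C`, which is closed up to `T`. All later uses of connectivity
-- to refute something take this form, with `C` often a corner of two separations.
noSmallCut : {G : FinGraph n} → KConnected k G →
             (T : Fin n → Bool) → # T < k →
             (C : Fin n → Set) → (∀ {a b} → C a → Adj G a b → T b ≡ true ⊎ C b) →
             ∀ {a b} → C a → T a ≡ false → ¬ C b → T b ≡ false → ⊥
noSmallCut {k = k} {G} (_ , conn) T T<k C closed {a} {b} Ca Ta ¬Cb Tb =
  ¬Cb (stays (conn (tabulate T) (subst (_< k) (sym (∣tabulate∣ T)) T<k)
                   (a , ∉-tabulate⁺ Ta) (b , ∉-tabulate⁺ Tb)) Ca)
  where
  stays : ∀ {u v} → Star (Adj (deleteVertices G (tabulate T))) u v → C (proj₁ u) → C (proj₁ v)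
  stays ε Cu = Cu
  stays (_◅_ {j = w} uw wv) Cu with closed Cu uw
  ... | inj₁ Tw = ⊥-elim (∉-tabulate⁻ (proj₂ w) Tw)
  ... | inj₂ Cw = stays wv Cw

Side : Set
Side = Fin 3

pattern left  = zero
pattern mid   = suc zero
pattern right = suc (suc zero)

isMid isRight : Side → Bool
isMid left  = false
isMid mid   = true
isMid right = false
isRight left  = false
isRight mid   = false
isRight right = true

-- The partition σ certifies that the edge x y is critical: once it is deleted,
-- fewer than k vertices separate x from y.
Separates : FinGraph n → ℕ → Fin n → Fin n → (Fin n → Side) → Set
Separates G k x y σ =
  σ x ≡ left × σ y ≡ right × # (isMid ∘ σ) < k ×
  (∀ a b → σ a ≡ left → σ b ≡ right → Adj G a b → a ≡ x × b ≡ y)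

separates? : (G : FinGraph n) (k : ℕ) (x y : Fin n) (σ : Fin n → Side) → Dec (Separates G k x y σ)
separates? G k x y σ =
  σ x ≟ left ×-dec σ y ≟ right ×-dec # (isMid ∘ σ) <? k ×-dec
  all? (λ a → all? (λ b → σ a ≟ left →-dec σ b ≟ right →-dec adj? G a b →-dec (a ≟ x ×-dec b ≟ y)))

separates-cong : {G : FinGraph n} {x y : Fin n} {σ τ : Fin n → Side} → (∀ i → τ i ≡ σ i) →
                 Separates G k x y σ → Separates G k x y τ
separates-cong {x = x} {y} τ≗σ (xL , yR , small , only) =
  trans (τ≗σ x) xL , trans (τ≗σ y) yR ,
  ≤-<-trans (≤-reflexive (sum-cong-≗ (cong (χ ∘ isMid) ∘ τ≗σ))) small ,
  λ a b aL bR → only a b (trans (sym (τ≗σ a)) aL) (trans (sym (τ≗σ b)) bR)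

separates-swap : {G : FinGraph n} {x y : Fin n} {σ : Fin n → Side} →
                 Separates G k x y σ → Separates G k y x (opposite ∘ σ)
separates-swap {n} {G = G} {σ = σ} (xL , yR , small , only) =
  cong opposite yR , cong opposite xL ,
  ≤-<-trans (≤-reflexive (sum-cong-≗ (cong χ ∘ isMid-opposite ∘ σ))) small ,
  λ a b aL bR ab → let b≡x , a≡y = only b a (to-left bR) (to-right aL) (D.sym G ab) in a≡y , b≡x
  where
  isMid-opposite : ∀ s → isMid (opposite s) ≡ isMid s
  isMid-opposite left  = refl
  isMid-opposite mid   = refl
  isMid-opposite right = refl
  to-left : ∀ {s} → opposite s ≡ right → s ≡ left
  to-left {left}  _ = refl
  to-left {mid}   ()
  to-left {right} ()
  to-right : ∀ {s} → opposite s ≡ left → s ≡ right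
  to-right {left}  ()
  to-right {mid}   ()
  to-right {right} _ = refl

-- Vectors rather than functions, so that a separation can be searched for.
Separation : FinGraph n → ℕ → Fin n → Fin n → Set
Separation {n} G k x y = ∃ λ (σ : Vec Side n) → Separates G k x y (lookup σ)

toSeparation : {G : FinGraph n} {x y : Fin n} {σ : Fin n → Side} → Separates G k x y σ → Separation G k x y
toSeparation {G = G} {σ = σ} sep = tabulate σ , separates-cong {G = G} (lookup∘tabulate σ) sep

anyVec? : ∀ {m n} {P : Vec (Fin m) n → Set} → (∀ v → Dec (P v)) → Dec (∃ P)
anyVec? {n = zero}  P? = map′ ([] ,_) (λ { ([] , p) → p }) (P? [])
anyVec? {n = suc n} P? =
  map′ (λ (i , v , p) → i ∷ v , p) (λ { (i ∷ v , p) → i , v , p }) (any? λ i → anyVec? (P? ∘ (i ∷_)))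

separation? : (G : FinGraph n) (k : ℕ) (x y : Fin n) → Dec (Separation G k x y)
separation? G k x y = anyVec? (separates? G k x y ∘ lookup)

-- Deleting an edge without a separation

Reachable : (G : FinGraph n) (S : Subset n) → (∃ λ v → v ∉ S) → Fin n → Set
Reachable G S u v = Σ (v ∉ S) λ v∉S → Star (Adj (deleteVertices G S)) u (v , v∉S)

-- Adding neighbours outside `S` one at a time must stop, since subsets cannot grow forever. Having
-- the component as a `Subset` makes membership in it decidable.
component : (G : FinGraph n) (S : Subset n) (u : ∃ λ v → v ∉ S) →
            ∃ λ (C : Subset n) → proj₁ u ∈ C × (∀ {c} → c ∈ C → Reachable G S u c) ×
              (∀ {c d} → c ∈ C → d ∉ S → Adj G c d → d ∈ C)
component {n} G S u@(u₀ , u∉S) =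
  grow ⁅ u₀ ⁆ (⊃-wellFounded _) (x∈⁅x⁆ u₀)
    (λ c∈ → subst (Reachable G S u) (sym (x∈⁅y⁆⇒x≡y u₀ c∈)) (u∉S , ε))
  where
  grow : (C : Subset n) → Acc _⊃_ C → u₀ ∈ C → (∀ {c} → c ∈ C → Reachable G S u c) →
         ∃ λ (C : Subset n) → u₀ ∈ C × (∀ {c} → c ∈ C → Reachable G S u c) ×
              (∀ {c d} → c ∈ C → d ∉ S → Adj G c d → d ∈ C)
  grow C (acc rec) u∈C reach
    with any? (λ c → any? (λ d → c ∈? C ×-dec ¬? (d ∈? S) ×-dec adj? G c d ×-dec ¬? (d ∈? C)))
  ... | no ¬step = C , u∈C , reach , λ {c} {d} c∈C d∉S cd →
    decidable-stable (d ∈? C) λ d∉C → ¬step (c , d , c∈C , d∉S , cd , d∉C)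
  ... | yes (c , d , c∈C , d∉S , cd , d∉C) =
    grow (C ∪ ⁅ d ⁆) (rec (p⊆p∪q _ , d , x∈p∪q⁺ (inj₂ (x∈⁅x⁆ d)) , d∉C)) (x∈p∪q⁺ (inj₁ u∈C))
      (extend ∘ x∈p∪q⁻ C ⁅ d ⁆)
    where
    extend : ∀ {e} → e ∈ C ⊎ e ∈ ⁅ d ⁆ → Reachable G S u e
    extend (inj₁ e∈C) = reach e∈C
    extend (inj₂ e∈d) = subst (Reachable G S u) (sym (x∈⁅y⁆⇒x≡y d e∈d))
      (d∉S , proj₂ (reach c∈C) ◅◅ (cd ◅ ε))

-- If `H - S` is disconnected, take the component of one vertex, `S`, and the rest. No edge of `H`
-- runs from the component to the rest, so only uv can do so in `G`. If it does, the partition or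
-- its mirror image is a separation; otherwise `S` is a small cut of `G`.
kConnected-deleteEdge : {G H : FinGraph n} {u v : Fin n} → KConnected k G →
  (∀ {a b} → Adj G a b → Adj H a b ⊎ (a ≡ u × b ≡ v) ⊎ (a ≡ v × b ≡ u)) →
  ¬ Separation G k u v → KConnected k H
kConnected-deleteEdge {n} {k} {G} {H} {u} {v} conG@(k<n , _) keeps ¬sep = k<n , connected
  where
  connected : ∀ S → ∣ S ∣ < k → Connected (deleteVertices H S)
  connected S S<k a@(a₀ , a∉S) (b₀ , b∉S) with component H S a
  ... | C , a∈C , reach , closed with b₀ ∈? C
  ...   | yes b∈C = proj₂ (reach b∈C)
  ...   | no  b∉C = ⊥-elim (noSmallCut {G = G} conG (isMid ∘ σ) small (λ c → σ c ≡ left) σ-closed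
                      (in-C a∈C) (cong isMid (in-C a∈C)) (λ bL → b∉C (left⇒∈C bL))
                      (cong isMid (not-in-C b∉S b∉C)))
    where
    σ : Fin n → Side
    σ c with c ∈? C | c ∈? S
    ... | yes _ | _     = left
    ... | no  _ | yes _ = mid
    ... | no  _ | no  _ = right
    in-C : ∀ {c} → c ∈ C → σ c ≡ left
    in-C {c} c∈C with c ∈? C
    ... | yes _   = refl
    ... | no  c∉C = contradiction c∈C c∉C
    not-in-C : ∀ {c} → c ∉ S → c ∉ C → σ c ≡ right
    not-in-C {c} c∉S c∉C with c ∈? C | c ∈? S
    ... | yes c∈C | _       = contradiction c∈C c∉C
    ... | no  _   | yes c∈S = contradiction c∈S c∉S
    ... | no  _   | no  _   = refl
    left⇒∈C : ∀ {c} → σ c ≡ left → c ∈ C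
    left⇒∈C {c} eq with c ∈? C | c ∈? S
    left⇒∈C _  | yes c∈C | _ = c∈C
    left⇒∈C () | no _ | yes _
    left⇒∈C () | no _ | no _
    right⇒∉ : ∀ {c} → σ c ≡ right → c ∉ S × c ∉ C
    right⇒∉ {c} eq with c ∈? C | c ∈? S
    right⇒∉ () | yes _ | _
    right⇒∉ () | no _ | yes _
    right⇒∉ _  | no c∉C | no c∉S = c∉S , c∉C
    isMid-σ : ∀ c → χ (isMid (σ c)) ≤ χ (lookup S c)
    isMid-σ c with c ∈? C | c ∈? S
    ... | yes _ | _       = z≤n
    ... | no  _ | yes c∈S = χ-positive ([]=⇒lookup c∈S)
    ... | no  _ | no  _   = z≤n
    small : # (isMid ∘ σ) < k
    small = ≤-<-trans (sum-mono isMid-σ) (subst (_< k) (∣∣≡# S) S<k)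
    crossing : ∀ {c d} → σ c ≡ left → σ d ≡ right → Adj G c d → (c ≡ u × d ≡ v) ⊎ (c ≡ v × d ≡ u)
    crossing cL dR cd with keeps cd
    ... | inj₂ uv = uv
    ... | inj₁ cd′ with right⇒∉ dR
    ...   | d∉S , d∉C = contradiction (closed (left⇒∈C cL) d∉S cd′) d∉C
    left≢right : ∀ {c} → σ c ≡ left → σ c ≢ right
    left≢right cL cR with trans (sym cL) cR
    ... | ()
    uncrossed : ∀ {c d} → σ c ≡ left → σ d ≡ right → ¬ Adj G c d
    uncrossed cL dR cd with crossing cL dR cd
    ... | inj₁ (refl , refl) = ¬sep (toSeparation {G = G} {σ = σ} (cL , dR , small , only))
      where
      only : ∀ x y → σ x ≡ left → σ y ≡ right → Adj G x y → x ≡ u × y ≡ v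
      only x y xL yR xy with crossing xL yR xy
      ... | inj₁ uv            = uv
      ... | inj₂ (refl , refl) = contradiction yR (left≢right cL)
    ... | inj₂ (refl , refl) =
      ¬sep (toSeparation {G = G} (separates-swap {G = G} {σ = σ} (cL , dR , small , only)))
      where
      only : ∀ x y → σ x ≡ left → σ y ≡ right → Adj G x y → x ≡ v × y ≡ u
      only x y xL yR xy with crossing xL yR xy
      ... | inj₂ vu            = vu
      ... | inj₁ (refl , refl) = contradiction yR (left≢right cL)
    σ-closed : ∀ {c d} → σ c ≡ left → Adj G c d → isMid (σ d) ≡ true ⊎ σ d ≡ left
    σ-closed {c} {d} cL cd = by-side (σ d) refl
      where
      by-side : ∀ s → σ d ≡ s → isMid s ≡ true ⊎ s ≡ left
      by-side left  _  = inj₂ refl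
      by-side mid   _  = inj₁ refl
      by-side right dR = contradiction cd (uncrossed cL dR)

-- Walking along critical edges

-- For sides s and t of a vertex in two separations, `cornerLR` marks the separator bounding the
-- corner left of the first and right of the second; `cornerRL` belongs to the opposite corner.
cornerLR cornerRL : Side → Side → Bool
cornerLR left  mid   = true
cornerLR mid   mid   = true
cornerLR mid   right = true
cornerLR _     _     = false
cornerRL s t = cornerLR t s

-- Summed over all vertices, this is the submodularity of separators under crossing.
corners-≤ : ∀ s t → χ (cornerLR s t) + χ (cornerRL s t) ≤ χ (isMid s) + χ (isMid t)
corners-≤ left  left  = z≤n
corners-≤ left  mid   = ≤-refl
corners-≤ left  right = z≤n
corners-≤ mid   left  = ≤-refl
corners-≤ mid   mid   = ≤-refl
corners-≤ mid   right = ≤-refl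
corners-≤ right left  = z≤n
corners-≤ right mid   = ≤-refl
corners-≤ right right = z≤n

module Descent {n k} (H : FinGraph n) (con : KConnected k H)
  {x y w} (x≢w : x ≢ w) (σ τ : Fin n → Side)
  (sepσ : Separates H k x y σ) (sepτ : Separates H k y w τ) (deg-y : k < degree H y) where

  private
    xL : σ x ≡ left
    xL = proj₁ sepσ
    yR : σ y ≡ right
    yR = proj₁ (proj₂ sepσ)
    yL : τ y ≡ left
    yL = proj₁ sepτ
    onlyσ : ∀ a b → σ a ≡ left → σ b ≡ right → Adj H a b → a ≡ x × b ≡ y
    onlyσ = proj₂ (proj₂ (proj₂ sepσ))
    onlyτ : ∀ a b → τ a ≡ left → τ b ≡ right → Adj H a b → a ≡ y × b ≡ w
    onlyτ = proj₂ (proj₂ (proj₂ sepτ))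

    LR RL : Fin n → Bool
    LR v = cornerLR (σ v) (τ v)
    RL v = cornerRL (σ v) (τ v)

  -- If y is not alone in its corner, then RL with y separates the rest of the corner from x.
  RL-large : k ≤ suc (# RL)
  RL-large = ≮⇒≥ λ RL+1<k → <⇒≱ deg-y (≤-trans (degree-≤-sum H y cover (covers RL+1<k))
    (≤-trans (≤-reflexive sum-cover) (≤-trans (≤-reflexive (+-comm (# RL) 2)) RL+1<k)))
    where
    -- Once y is alone in its corner, its neighbours lie in `RL`, except x across σ and w across τ.
    -- Its degree is then at most `# RL + 2`, hence at most k under the assumption.
    cover : Fin n → ℕ
    cover i = χ (RL i) + (at x i + at w i)
    sum-cover : sum cover ≡ # RL + 2
    sum-cover = trans (∑-distrib-+ (χ ∘ RL) _)
      (cong (λ m → # RL + m) (trans (∑-distrib-+ (at x) (at w)) (cong₂ _+_ (sum-at x) (sum-at w))))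
    T : Fin n → Bool
    T i = RL i ∨ does (i ≟ y)
    χ-∨ : ∀ b c → χ (b ∨ c) ≤ χ b + χ c
    χ-∨ true  _ = s≤s z≤n
    χ-∨ false _ = ≤-refl
    T-small : suc (# RL) < k → # T < k
    T-small = ≤-<-trans (≤-trans (sum-mono (λ i → χ-∨ (RL i) (does (i ≟ y))))
      (≤-reflexive (trans (∑-distrib-+ (χ ∘ RL) (at y)) (trans (cong (λ m → # RL + m) (sum-at y)) (+-comm (# RL) 1)))))
    C : Fin n → Set
    C v = (σ v ≡ right × τ v ≡ left) × v ≢ y
    closed : ∀ {a b} → C a → Adj H a b → T b ≡ true ⊎ C b
    closed {a} {b} ((aR , aL) , a≢y) ab = by-sides (σ b) (τ b) refl refl
      where
      by-sides : ∀ s t → σ b ≡ s → τ b ≡ t → T b ≡ true ⊎ C b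
      -- An edge from the corner to the left of σ can only be xy, and one to the right of τ only yw.
      -- Both start at y, which `C` leaves out.
      by-sides left  t     bs bt = contradiction (proj₂ (onlyσ b a bs aR (D.sym H ab))) a≢y
      by-sides mid   right bs bt = contradiction (proj₁ (onlyτ a b aL bt ab)) a≢y
      by-sides right right bs bt = contradiction (proj₁ (onlyτ a b aL bt ab)) a≢y
      by-sides mid   left  bs bt rewrite bs | bt = inj₁ refl
      by-sides mid   mid   bs bt rewrite bs | bt = inj₁ refl
      by-sides right mid   bs bt rewrite bs | bt = inj₁ refl
      by-sides right left  bs bt with b ≟ y
      ... | yes _   = inj₁ (∨-zeroʳ (RL b))
      ... | no  b≢y = inj₂ ((bs , bt) , b≢y)
    x≢y : x ≢ y
    x≢y refl with trans (sym xL) yR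
    ... | ()
    RL-left : ∀ {s} t → s ≡ left → cornerRL s t ≡ false
    RL-left left  refl = refl
    RL-left mid   refl = refl
    RL-left right refl = refl
    Tx : T x ≡ false
    Tx with x ≟ y
    ... | yes x≡y = contradiction x≡y x≢y
    ... | no  _   = trans (∨-identityʳ (RL x)) (RL-left (τ x) xL)
    ¬Cx : ¬ C x
    ¬Cx ((xR , _) , _) with trans (sym xL) xR
    ... | ()
    lonely : suc (# RL) < k → ∀ {c} → ¬ C c
    lonely RL+1<k {c} Cc = noSmallCut {G = H} con T (T-small RL+1<k) C closed Cc Tc ¬Cx Tx
      where
      Tc : T c ≡ false
      Tc with c ≟ y
      ... | yes c≡y = contradiction c≡y (proj₂ Cc)
      ... | no  _   rewrite proj₁ (proj₁ Cc) | proj₂ (proj₁ Cc) = refl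
    covers : suc (# RL) < k → ∀ i → Adj H y i → 1 ≤ cover i
    covers RL+1<k i yi = by-sides (σ i) (τ i) refl refl
      where
      RL-covers : RL i ≡ true → 1 ≤ cover i
      RL-covers eq = ≤-trans (χ-positive eq) (m≤m+n _ _)
      by-sides : ∀ s t → σ i ≡ s → τ i ≡ t → 1 ≤ cover i
      by-sides left  t is it with onlyσ i y is yR (D.sym H yi)
      ... | refl , _ = ≤-trans (≤-reflexive (sym (at-self x))) (≤-trans (m≤m+n _ _) (m≤n+m _ (χ (RL x))))
      by-sides s right is it with onlyτ y i yL it yi
      ... | _ , refl = ≤-trans (≤-reflexive (sym (at-self w))) (≤-trans (m≤n+m _ (at x w)) (m≤n+m _ (χ (RL w))))
      by-sides mid   left is it = RL-covers (cong₂ cornerRL is it)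
      by-sides mid   mid  is it = RL-covers (cong₂ cornerRL is it)
      by-sides right mid  is it = RL-covers (cong₂ cornerRL is it)
      by-sides right left is it = contradiction ((is , it) , i≢y) (lonely RL+1<k)
        where
        i≢y : i ≢ y
        i≢y refl = irrefl H refl yi

  -- Since `RL` has at least k - 1 vertices, submodularity leaves at most k - 1 for `LR`, so `LR`
  -- would cut a nonempty corner off from y. An edge leaving the corner past `LR` would have to be
  -- both xy and yw, which `x≢w` excludes.
  LR-empty : ∀ {v} → σ v ≡ left → τ v ≢ right
  LR-empty {v} vL vR = noSmallCut {G = H} con LR LR<k C closed (vL , vR) (cong₂ cornerLR vL vR)
    ¬Cy (cong₂ cornerLR yR yL)
    where
    C : Fin n → Set
    C u = σ u ≡ left × τ u ≡ right
    ¬Cy : ¬ C y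
    ¬Cy (yL′ , _) with trans (sym yR) yL′
    ... | ()
    only-x : ∀ {a b} → C a → Adj H a b → σ b ≢ right
    only-x {a} {b} (aL , aR) ab bR with onlyσ a b aL bR ab
    ... | refl , refl = x≢w (proj₂ (onlyτ y x yL aR (D.sym H ab)))
    LR<k : # LR < k
    LR<k = ≰⇒> λ k≤LR → <-irrefl refl (begin-strict
      k + k                                   ≤⟨ +-mono-≤ k≤LR RL-large ⟩
      # LR + suc (# RL)                       ≡⟨ +-suc (# LR) (# RL) ⟩
      suc (# LR + # RL)                       ≤⟨ s≤s (sum-mono₂ (χ ∘ LR) (χ ∘ RL) (χ ∘ isMid ∘ σ) (χ ∘ isMid ∘ τ)
                                                   (λ i → corners-≤ (σ i) (τ i))) ⟩
      suc (# (isMid ∘ σ) + # (isMid ∘ τ))     <⟨ +-mono-≤-< small-σ small-τ ⟩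
      k + k                                   ∎)
      where
      open ≤-Reasoning
      small-σ : # (isMid ∘ σ) < k
      small-σ = proj₁ (proj₂ (proj₂ sepσ))
      small-τ : # (isMid ∘ τ) < k
      small-τ = proj₁ (proj₂ (proj₂ sepτ))
    closed : ∀ {a b} → C a → Adj H a b → LR b ≡ true ⊎ C b
    closed {a} {b} Ca@(aL , aR) ab = by-sides (σ b) (τ b) refl refl
      where
      by-sides : ∀ s t → σ b ≡ s → τ b ≡ t → LR b ≡ true ⊎ C b
      by-sides right t     bs bt = contradiction bs (only-x Ca ab)
      by-sides left  left  bs bt with onlyτ b a bt aR (D.sym H ab)
      ... | refl , _ = contradiction yR (only-x Ca ab)
      by-sides mid   left  bs bt with onlyτ b a bt aR (D.sym H ab)
      ... | refl , _ = contradiction yR (only-x Ca ab)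
      by-sides left  mid   bs bt = inj₁ (cong₂ cornerLR bs bt)
      by-sides mid   mid   bs bt = inj₁ (cong₂ cornerLR bs bt)
      by-sides mid   right bs bt = inj₁ (cong₂ cornerLR bs bt)
      by-sides left  right bs bt = inj₂ (bs , bt)

  -- By `LR-empty`, the disjoint sets `RL`, {y} and the right side of τ all lie in the middle and
  -- right of σ. The first two have at least k vertices together, the middle of σ fewer than k.
  far-decreases : # (isRight ∘ τ) < # (isRight ∘ σ)
  far-decreases = ≰⇒> λ far-σ≤far-τ → <-irrefl refl (begin-strict
    k + # (isRight ∘ σ)                                  ≤⟨ +-mono-≤ RL-large far-σ≤far-τ ⟩
    suc (# RL) + # (isRight ∘ τ)                         ≡⟨ cong (_+ # (isRight ∘ τ)) (+-comm 1 (# RL)) ⟩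
    (# RL + 1) + # (isRight ∘ τ)                         ≡⟨ cong (λ m → (# RL + m) + # (isRight ∘ τ)) (sum-at y) ⟨
    (# RL + sum (at y)) + # (isRight ∘ τ)                ≡⟨ cong (_+ # (isRight ∘ τ)) (∑-distrib-+ (χ ∘ RL) (at y)) ⟨
    sum (λ i → χ (RL i) + at y i) + # (isRight ∘ τ)      ≤⟨ sum-mono₂ _ (χ ∘ isRight ∘ τ) (χ ∘ isMid ∘ σ) (χ ∘ isRight ∘ σ) pointwise ⟩
    # (isMid ∘ σ) + # (isRight ∘ σ)                      <⟨ +-monoˡ-< _ (proj₁ (proj₂ (proj₂ sepσ))) ⟩
    k + # (isRight ∘ σ)                                  ∎)
    where
    open ≤-Reasoning
    by-sides : ∀ s t → (s ≡ left → t ≢ right) →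
               χ (cornerRL s t) + 0 + χ (isRight t) ≤ χ (isMid s) + χ (isRight s)
    by-sides left  left  _ = z≤n
    by-sides left  mid   _ = z≤n
    by-sides left  right e = contradiction refl (e refl)
    by-sides mid   left  _ = ≤-refl
    by-sides mid   mid   _ = ≤-refl
    by-sides mid   right _ = ≤-refl
    by-sides right left  _ = z≤n
    by-sides right mid   _ = ≤-refl
    by-sides right right _ = ≤-refl
    pointwise : ∀ i → χ (RL i) + at y i + χ (isRight (τ i)) ≤ χ (isMid (σ i)) + χ (isRight (σ i))
    pointwise i with i ≟ y
    ... | yes refl rewrite yR | yL = ≤-refl
    ... | no  _    = by-sides (σ i) (τ i) LR-empty

-- c v = 0 says that v is uncovered by the matching deleted from H.
module Core {n k N} (H : FinGraph n) (con : KConnected k H)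
  (c : Fin n → ℕ) (sum-c : sum c ≤ N)
  (deg>k : ∀ v → c v ≡ 0 → k < degree H v) (deg>N : ∀ v → c v ≡ 0 → N < degree H v)
  (critical : ∀ u v → c u ≡ 0 → c v ≡ 0 → Adj H u v → Separation H k u v) where

  private
    record Arc (u v : Fin n) : Set where
      constructor arc
      field
        tail-free : c u ≡ 0
        head-free : c v ≡ 0
        joined    : Adj H u v
    open Arc

    separation : ∀ {u v} → Arc u v → Separation H k u v
    separation e = critical _ _ (tail-free e) (head-free e) (joined e)

    -- The chosen separation may depend on the direction and the proofs in an arc, so the measure is
    -- attached to arcs, and trails below record whole arcs.
    far : ∀ {u v} → Arc u v → ℕ
    far e = # (isRight ∘ lookup (proj₁ (separation e)))

    descend : ∀ {u v w} (e : Arc u v) (f : Arc v w) → u ≢ w → far f < far e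
    descend e f u≢w =
      Descent.far-decreases H con u≢w _ _ (proj₂ (separation e)) (proj₂ (separation f)) (deg>k _ (head-free e))

    DeadEnd : Fin n → Fin n → Set
    DeadEnd x y = Arc x y × (∀ w → c w ≡ 0 → Adj H y w → w ≡ x)

    -- Every continuation that does not turn back lowers `far`, so the walk stops.
    dead-end : ∀ {u v} (e : Arc u v) → Acc _<_ (far e) → ∃ λ x → ∃ λ y → DeadEnd x y
    dead-end {u} {v} e (acc rec)
      with any? (λ w → c w ≟ℕ 0 ×-dec adj? H v w ×-dec ¬? (u ≟ w))
    ... | yes (w , w-free , vw , u≢w) =
      let f = arc (head-free e) w-free vw in dead-end f (rec (descend e f u≢w))
    ... | no stuck = u , v , e , λ w w-free vw →
      sym (decidable-stable (u ≟ w) λ u≢w → stuck (w , w-free , vw , u≢w))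

  module _ {x y} (end : DeadEnd x y) where
    private
      xy : Arc x y
      xy = proj₁ end
      σ : Fin n → Side
      σ = lookup (proj₁ (separation xy))
      sepσ : Separates H k x y σ
      sepσ = proj₂ (separation xy)
      onlyσ : ∀ a b → σ a ≡ left → σ b ≡ right → Adj H a b → a ≡ x × b ≡ y
      onlyσ = proj₂ (proj₂ (proj₂ sepσ))

      x≢y : x ≢ y
      x≢y x≡y = irrefl H x≡y (joined xy)

      -- Counting the neighbours of y shows that y is adjacent to every covered vertex.
      left-free : ∀ {v} → σ v ≡ left → c v ≡ 0
      left-free {v} vL = decidable-stable (c v ≟ℕ 0) λ v-covered →
        -- If v is covered, y misses it: on the left only x can be adjacent to y, and x is
        -- uncovered. Every neighbour of y is covered or equal to x, so missing v leaves a degree of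
        -- at most N.
        let ¬yv = λ yv → v-covered (trans (cong c (proj₁ (onlyσ v y vL (proj₁ (proj₂ sepσ)) (D.sym H yv)))) (tail-free xy))
        in <-irrefl refl (begin-strict
             suc N                             ≤⟨ deg>N y (head-free xy) ⟩
             degree H y                        <⟨ degree-<-sum H y v (λ i → c i + at x i) ¬yv
                                                    (≤-trans (n≢0⇒n>0 v-covered) (m≤m+n _ _)) covers ⟩
             sum (λ i → c i + at x i)          ≡⟨ ∑-distrib-+ c (at x) ⟩
             sum c + sum (at x)                ≡⟨ cong (λ m → sum c + m) (sum-at x) ⟩
             sum c + 1                         ≤⟨ +-monoˡ-≤ 1 sum-c ⟩
             N + 1                             ≡⟨ +-comm N 1 ⟩
             suc N                             ∎)
        where
        open ≤-Reasoning
        covers : ∀ i → Adj H y i → 1 ≤ c i + at x i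
        covers i yi with c i ≟ℕ 0
        ... | no  ci≢0 = ≤-trans (n≢0⇒n>0 ci≢0) (m≤m+n _ _)
        ... | yes ci≡0 with proj₂ end i ci≡0 yi
        ...   | refl = ≤-trans (≤-reflexive (sym (at-self x))) (m≤n+m _ (c x))

      -- Fewer than k of the more than k neighbours of v are in the middle. A neighbour on the right
      -- occurs only for v = x and is y, which `v ≡ x → u ≡ y` identifies with u. So a neighbour
      -- other than u remains on the left.
      onward : ∀ {u v} → σ v ≡ left → (v ≡ x → u ≡ y) → ∃ λ w → σ w ≡ left × Adj H v w × w ≢ u
      onward {u} {v} vL from-y
        with any? (λ w → σ w ≟ left ×-dec adj? H v w ×-dec ¬? (w ≟ u))
      ... | yes found = found
      ... | no  none  = contradiction (deg>k v (left-free vL)) (≤⇒≯ (begin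
        degree H v                               ≤⟨ degree-≤-sum H v (λ i → χ (isMid (σ i)) + at u i) covers ⟩
        sum (λ i → χ (isMid (σ i)) + at u i)     ≡⟨ ∑-distrib-+ (χ ∘ isMid ∘ σ) (at u) ⟩
        # (isMid ∘ σ) + sum (at u)               ≡⟨ cong (λ m → # (isMid ∘ σ) + m) (sum-at u) ⟩
        # (isMid ∘ σ) + 1                        ≡⟨ +-comm _ 1 ⟩
        suc (# (isMid ∘ σ))                      ≤⟨ proj₁ (proj₂ (proj₂ sepσ)) ⟩
        k                                        ∎))
        where
        open ≤-Reasoning
        at-u : ∀ {i} → i ≡ u → 1 ≤ χ (isMid (σ i)) + at u i
        at-u refl = ≤-trans (≤-reflexive (sym (at-self u))) (m≤n+m _ _)
        covers : ∀ i → Adj H v i → 1 ≤ χ (isMid (σ i)) + at u i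
        covers i vi = by-side (σ i) refl
          where
          by-side : ∀ s → σ i ≡ s → 1 ≤ χ (isMid (σ i)) + at u i
          by-side left  is = at-u (decidable-stable (i ≟ u) λ i≢u → none (i , is , vi , i≢u))
          by-side mid   is = ≤-trans (χ-positive (cong isMid is)) (m≤m+n _ _)
          by-side right is with onlyσ v i vL is vi
          ... | v≡x , i≡y = at-u (trans i≡y (sym (from-y v≡x)))

      -- Each visited z was left along an arc whose far side is at least as large as that
      -- of the current arc e, so a walk that closes up contradicts the descent.
      Trail : ∀ {u v} → Arc u v → List (Fin n) → Set
      Trail {u} {v} e vis = ∀ {z} → z L.∈ vis →
        ∃ λ z′ → Σ (Arc z z′) λ f → far e ≤ far f × (z ≡ u × z′ ≡ v ⊎ z′ L.∈ vis)

      -- The recursion is on `far`. As x stays among the current and visited vertices, a new vertex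
      -- is never x, so after the start the condition `v ≡ x → u ≡ y` holds vacuously.
      no-walk : ∀ {u v} (e : Arc u v) → Acc _<_ (far e) → (vis : List (Fin n)) → Trail e vis →
                v L.∉ vis → x L.∈ v ∷ vis → (v ≡ x → u ≡ y) → σ v ≡ left → ⊥
      no-walk {u} {v} e (acc rec) vis trail v∉vis x∈ from-y vL with onward vL from-y
      ... | w , wL , vw , w≢u = continue (w ∈L? vis)
        where
        f : Arc v w
        f = arc (head-free e) (left-free wL) vw
        f<e : far f < far e
        f<e = descend e f (≢-sym w≢u)
        trail′ : Trail f (v ∷ vis)
        trail′ (here refl) = w , f , ≤-refl , inj₁ (refl , refl)
        trail′ (there z∈) with trail z∈
        ... | z′ , g , e≤g , inj₁ (_ , refl) = z′ , g , ≤-trans (<⇒≤ f<e) e≤g , inj₂ (here refl)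
        ... | z′ , g , e≤g , inj₂ z′∈        = z′ , g , ≤-trans (<⇒≤ f<e) e≤g , inj₂ (there z′∈)
        continue : Dec (w L.∈ vis) → ⊥
        continue (yes w∈) with trail w∈
        ... | _  , _ , _   , inj₁ (w≡u , _) = w≢u w≡u
        -- Following f by the recorded arc g gives far g < far f < far e, against far e ≤ far g.
        -- Since z′ is visited and v is not, g does not turn back.
        ... | z′ , g , e≤g , inj₂ z′∈ =
          <-irrefl refl (≤-<-trans e≤g (<-trans (descend f g λ { refl → v∉vis z′∈ }) f<e))
        continue (no w∉) = no-walk f (rec f<e) (v ∷ vis) trail′ w∉v∷vis (there x∈)
          (λ { refl → contradiction x∈ w∉v∷vis }) wL
          where
          w∉v∷vis : w L.∉ v ∷ vis
          w∉v∷vis (here refl) = irrefl H refl vw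
          w∉v∷vis (there w∈)  = w∉ w∈

    no-dead-end : ⊥
    no-dead-end = no-walk yx (<-wellFounded _) (y ∷ []) (λ { (here refl) → x , yx , ≤-refl , inj₁ (refl , refl) })
      (λ { (here x≡y) → x≢y x≡y }) (here refl) (λ _ → refl) (proj₁ sepσ)
      where
      yx : Arc y x
      yx = arc (head-free xy) (tail-free xy) (D.sym H (joined xy))

  -- An uncovered v has too many neighbours for all of them to be covered, and an uncovered
  -- neighbour starts a walk to a dead end.
  all-covered : ∀ v → c v ≢ 0
  all-covered v v-free with any? (λ w → c w ≟ℕ 0 ×-dec adj? H v w)
  ... | yes (w , w-free , vw) =
    let _ , _ , end = dead-end (arc v-free w-free vw) (<-wellFounded _) in no-dead-end end
  ... | no none = contradiction (deg>N v v-free) (≤⇒≯ (≤-trans (degree-≤-sum H v c covers) sum-c))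
    where
    covers : ∀ i → Adj H v i → 1 ≤ c i
    covers i vi = n≢0⇒n>0 λ ci≡0 → none (i , ci≡0 , vi)

-- Extending a removable matching

-- Ends are counted with multiplicity, so the total is twice the length by construction;
-- disjointness enters in `2size≤n`, where it bounds each value by one.
coverage : List (Fin n × Fin n) → Fin n → ℕ
coverage []             _ = 0
coverage ((a , b) ∷ es) i = (at a i + at b i) + coverage es i

sum-coverage : (es : List (Fin n × Fin n)) → sum (coverage es) ≡ 2 * length es
sum-coverage {n} []        = sum-replicate-zero n
sum-coverage ((a , b) ∷ es) = trans (∑-distrib-+ (λ i → at a i + at b i) (coverage es))
  (trans (cong₂ _+_ (trans (∑-distrib-+ (at a) (at b)) (cong₂ _+_ (sum-at a) (sum-at b))) (sum-coverage es))
         (sym (*-suc 2 (length es))))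

coverage-ends : ∀ {a b : Fin n} {es} → (a , b) L.∈ es → coverage es a ≢ 0 × coverage es b ≢ 0
coverage-ends {a = a} {b} (here refl) =
  m<n⇒n≢0 (≤-trans (≤-trans (≤-reflexive (sym (at-self a))) (m≤m+n _ _)) (m≤m+n _ _)) ,
  m<n⇒n≢0 (≤-trans (≤-trans (≤-reflexive (sym (at-self b))) (m≤n+m _ (at a b))) (m≤m+n _ _))
coverage-ends {es = e ∷ _} (there ab∈) with coverage-ends ab∈
... | a≢0 , b≢0 = a≢0 ∘ m+n≡0⇒n≡0 _ , b≢0 ∘ m+n≡0⇒n≡0 _

uncovered-disjoint : ∀ {u v : Fin n} (es : List (Fin n × Fin n)) → coverage es u ≡ 0 → coverage es v ≡ 0 →
            All (VertexDisjoint (u , v)) es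
uncovered-disjoint [] _ _ = []
uncovered-disjoint ((a , b) ∷ es) u-free v-free =
  (apart a u-free (m≤m+n _ _) , apart b u-free (m≤n+m _ _) , apart a v-free (m≤m+n _ _) , apart b v-free (m≤n+m _ _))
  ∷ uncovered-disjoint es (m+n≡0⇒n≡0 _ u-free) (m+n≡0⇒n≡0 _ v-free)
  where
  apart : ∀ {w} x → coverage ((a , b) ∷ es) w ≡ 0 → at x w ≤ at a w + at b w → w ≢ x
  apart x w-free le refl = m<n⇒n≢0 (≤-trans (≤-trans (≤-reflexive (sym (at-self x))) le) (m≤m+n _ _)) w-free

module Extension {n k} (G : FinGraph n) (deg>k : ∀ v → k < degree G v)
  (M : Matching G) (removable : Removable k G M) (deg>2s : ∀ v → 2 * size M < degree G v) (v₀ : Fin n) where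

  private
    es : List (Fin n × Fin n)
    es = edges M

    c : Fin n → ℕ
    c = coverage es

    H : FinGraph n
    H = deleteMatching G M

    adj-free : ∀ {u v} → c u ≡ 0 → Adj G u v → Adj H u v
    adj-free u-free uv = uv , (λ uv∈ → proj₁ (coverage-ends uv∈) u-free) , (λ vu∈ → proj₂ (coverage-ends vu∈) u-free)

    -- Deleted edges have covered ends, so the degree bounds of `G` pass to `H` at uncovered
    -- vertices.
    degree-free : ∀ {u} → c u ≡ 0 → degree G u ≤ degree H u
    degree-free {u} u-free = ≤-trans
      (degree-≤-sum G u (χ ∘ does ∘ adj? H u) λ i ui → χ-positive (dec-true (adj? H u i) (adj-free u-free ui)))
      (≤-reflexive (sym (degree≡# H u)))

    -- Were all vertices covered, the degree of `v₀` would be at most the total coverage,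
    -- `2 * size M`.
    free-vertex : ∃ λ v → c v ≡ 0
    free-vertex with any? (λ v → c v ≟ℕ 0)
    ... | yes found = found
    ... | no  none  = contradiction (deg>2s v₀) (≤⇒≯ (≤-trans
      (degree-≤-sum G v₀ c λ i _ → n≢0⇒n>0 λ ci≡0 → none (i , ci≡0)) (≤-reflexive (sum-coverage es))))

    add : ∀ u v → c u ≡ 0 → c v ≡ 0 → Adj H u v → Matching G
    add u v u-free v-free uv = record
      { edges    = (u , v) ∷ es
      ; inGraph  = proj₁ uv ∷ inGraph M
      ; disjoint = uncovered-disjoint es u-free v-free ∷ disjoint M
      }

    add-removable : ∀ u v u-free v-free uv → ¬ Separation H k u v → Removable k G (add u v u-free v-free uv)
    add-removable u v u-free v-free uv = kConnected-deleteEdge {G = H} {H = H′} removable keeps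
      where
      H′ : FinGraph n
      H′ = deleteMatching G (add u v u-free v-free uv)
      keeps : ∀ {a b} → Adj H a b → Adj H′ a b ⊎ (a ≡ u × b ≡ v) ⊎ (a ≡ v × b ≡ u)
      keeps {a} {b} (ab , ab∉ , ba∉) with (a ≟ u) ×-dec (b ≟ v) | (a ≟ v) ×-dec (b ≟ u)
      ... | yes p | _     = inj₂ (inj₁ p)
      ... | no  _ | yes q = inj₂ (inj₂ q)
      ... | no ¬p | no ¬q = inj₁ (ab , (λ { (here refl) → ¬p (refl , refl) ; (there ∈) → ab∉ ∈ }) ,
                                       (λ { (here refl) → ¬q (refl , refl) ; (there ∈) → ba∉ ∈ }))

  extend : Σ (Matching G) λ M′ → Removable k G M′ × size M′ ≡ suc (size M)
  extend with any? (λ u → any? (λ v →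
    c u ≟ℕ 0 ×-dec c v ≟ℕ 0 ×-dec adj? H u v ×-dec ¬? (separation? H k u v)))
  ... | yes (u , v , u-free , v-free , uv , ¬sep) =
    add u v u-free v-free uv , add-removable u v u-free v-free uv ¬sep , refl
  ... | no none with free-vertex
  ...   | v , v-free = ⊥-elim (Core.all-covered H removable c (≤-reflexive (sum-coverage es))
    (λ w w-free → ≤-trans (deg>k w) (degree-free w-free))
    (λ w w-free → ≤-trans (deg>2s w) (degree-free w-free))
    (λ u w u-free w-free uw → decidable-stable (separation? H k u w) λ ¬sep →
      none (u , w , u-free , w-free , uw , ¬sep))
    v v-free)

grow-matching : ∀ {m} (G : FinGraph n) → KConnected k G → (∀ v → k < degree G v) →
  (∀ v → 2 * m ∸ 1 ≤ degree G v) → ∀ s → s ≤ m → Σ (Matching G) λ M → Removable k G M × size M ≡ s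
grow-matching G (k<n , conn) _ _ zero _ = record { edges = [] ; inGraph = [] ; disjoint = [] } ,
  (k<n , λ S S<k u v → Star.map (λ uv → uv , (λ ()) , (λ ())) (conn S S<k u v)) , refl
grow-matching {suc n} {m = m} G con deg>k deg≥ (suc s) s<m
  with grow-matching G con deg>k deg≥ s (<⇒≤ s<m)
... | M , removable , refl = Extension.extend G deg>k M removable
  -- From s < m follows 2s + 2 ≤ 2m, so 2m - 1 exceeds 2s.
  (λ v → ≤-trans (∸-monoˡ-≤ 1 (≤-trans (≤-reflexive (sym (*-suc 2 s))) (*-monoʳ-≤ 2 s<m))) (deg≥ v)) zero
grow-matching {zero} G (() , _) _ _ (suc _) _

δ-≤-degree : (G : FinGraph n) (v : Fin n) → δ G ≤ degree G v
δ-≤-degree {n} G v = All.lookup (min≤xs n (map (degree G) (allFin n))) (∈-map⁺ (degree G) (∈-allFin v))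

guarantees : ∀ k m → Guarantees k m (+ ((k + 1) ⊔ (2 * m ∸ 1)))
guarantees k m G con (+≤+ d≤δ) = grow-matching {m = m} G con
  (λ v → ≤-trans (≤-reflexive (+-comm 1 k)) (≤-trans (m≤m⊔n (k + 1) _) (≤-trans d≤δ (δ-≤-degree G v))))
  (λ v → ≤-trans (m≤n⊔m (k + 1) _) (≤-trans d≤δ (δ-≤-degree G v)))
  m ≤-refl

-- Complete graphs

complete : ∀ n → FinGraph n
complete n = record { Adj = _≢_ ; adj? = λ u v → ¬? (u ≟ v) ; sym = ≢-sym ; irrefl = λ u≡v u≢v → u≢v u≡v }

complete-kConnected : k < n → KConnected k (complete n)
complete-kConnected {k} {n} k<n = k<n , connected
  where
  connected : ∀ S → ∣ S ∣ < k → Connected (deleteVertices (complete n) S)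
  connected S _ (u , u∉) (v , v∉) with u ≟ v
  ... | yes refl = ε
  ... | no  u≢v  = u≢v ◅ ε

degree-complete : (v : Fin n) → n ≤ suc (degree (complete n) v)
degree-complete {n} v = begin
  n                                               ≡⟨ sum-ones n ⟨
  sum {n} (λ _ → 1)                               ≤⟨ sum-mono pointwise ⟩
  sum (λ i → at v i + χ (does (¬? (v ≟ i))))      ≡⟨ ∑-distrib-+ (at v) _ ⟩
  sum (at v) + # (λ i → does (¬? (v ≟ i)))        ≡⟨ cong₂ _+_ (sum-at v) (sym (degree≡# (complete n) v)) ⟩
  suc (degree (complete n) v)                     ∎
  where
  open ≤-Reasoning
  pointwise : ∀ i → 1 ≤ at v i + χ (does (¬? (v ≟ i)))
  pointwise i with v ≟ i
  ... | yes refl = ≤-trans (≤-reflexive (sym (at-self v))) (m≤m+n _ _)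
  ... | no  _    = m≤n+m 1 (at v i)

δ-complete : ∀ n → n ≤ δ (complete (suc n))
-- The first argument handles the cap in `δ`, which is n + 1 here.
δ-complete n = v≤min⁺ (n≤1+n n)
  (AllP.map⁺ (All.universal (λ v → s≤s⁻¹ (degree-complete v)) (allFin (suc n))))

2size≤n : (G : FinGraph n) (M : Matching G) → 2 * size M ≤ n
2size≤n {n} G M = begin
  2 * size M                  ≡⟨ sum-coverage (edges M) ⟨
  sum (coverage (edges M))    ≤⟨ sum-mono (λ i → once (inGraph M) (disjoint M) i) ⟩
  sum {n} (λ _ → 1)           ≡⟨ sum-ones n ⟩
  n                           ∎
  where
  open ≤-Reasoning
  avoided : ∀ {a b es} → All (VertexDisjoint (a , b)) es → coverage es a ≡ 0 × coverage es b ≡ 0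
  avoided [] = refl , refl
  avoided ((a≢c , a≢d , b≢c , b≢d) ∷ ds) with avoided ds
  ... | a≡0 , b≡0 = cong₂ _+_ (cong₂ _+_ (at-≢ a≢c) (at-≢ a≢d)) a≡0 , cong₂ _+_ (cong₂ _+_ (at-≢ b≢c) (at-≢ b≢d)) b≡0
  once : ∀ {es} → All (λ (u , v) → Adj G u v) es → AllPairs VertexDisjoint es → ∀ i → coverage es i ≤ 1
  once [] [] i = z≤n
  once {(a , b) ∷ es} (ab ∷ as) (d ∷ ds) i with i ≟ a | i ≟ b
  ... | yes refl | yes refl = contradiction ab (irrefl G refl)
  ... | yes refl | no  _    = s≤s (≤-reflexive (proj₁ (avoided d)))
  ... | no  _    | yes refl = s≤s (≤-reflexive (proj₂ (avoided d)))
  ... | no  _    | no  _    = once as ds i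

-- After the deletion of an edge uv, the k - 1 other vertices separate u from v.
no-removable-edge : (M : Matching (complete (suc k))) → Removable k (complete (suc k)) M → ¬ (1 ≤ size M)
no-removable-edge {k} M@record { edges = (u , v) ∷ es ; inGraph = u≢v ∷ _ } removable _ =
  noSmallCut {G = deleteMatching (complete (suc k)) M} removable T T<k (_≡ u) closed refl Tu (≢-sym u≢v) Tv
  where
  T : Fin (suc k) → Bool
  T i = not (does (i ≟ u)) ∧ not (does (i ≟ v))
  Tu : T u ≡ false
  Tu rewrite dec-true (u ≟ u) refl = refl
  Tv : T v ≡ false
  Tv rewrite dec-true (v ≟ v) refl = ∧-zeroʳ _
  pointwise : ∀ i → χ (T i) + (at u i + at v i) ≤ 1
  pointwise i with i ≟ u | i ≟ v
  ... | yes refl | yes refl = contradiction refl u≢v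
  ... | yes _    | no  _    = ≤-refl
  ... | no  _    | yes _    = ≤-refl
  ... | no  _    | no  _    = ≤-refl
  T<k : # T < k
  T<k = s≤s⁻¹ (begin
    suc (suc (# T))                            ≡⟨ +-comm 2 (# T) ⟩
    # T + 2                                    ≡⟨ cong (λ m → # T + m) (cong₂ _+_ (sum-at u) (sum-at v)) ⟨
    # T + (sum (at u) + sum (at v))            ≡⟨ cong (λ m → # T + m) (∑-distrib-+ (at u) (at v)) ⟨
    # T + sum (λ i → at u i + at v i)          ≡⟨ ∑-distrib-+ (χ ∘ T) (λ i → at u i + at v i) ⟨
    sum (λ i → χ (T i) + (at u i + at v i))    ≤⟨ sum-mono pointwise ⟩
    sum {suc k} (λ _ → 1)                      ≡⟨ sum-ones (suc k) ⟩
    suc k                                      ∎)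
    where open ≤-Reasoning
  closed : ∀ {a b} → a ≡ u → Adj (deleteMatching (complete (suc k)) M) a b → T b ≡ true ⊎ b ≡ u
  closed {b = b} refl (_ , ub∉ , _) with b ≟ u | b ≟ v
  ... | yes b≡u | _        = inj₂ b≡u
  ... | no  _   | no  _    = inj₁ refl
  ... | no  _   | yes refl = contradiction (here refl) ub∉

complete-not-guaranteed : ∀ m n → 1 ≤ m → n ≡ k + 1 ⊎ n ≡ 2 * m ∸ 1 →
  ¬ (Σ (Matching (complete n)) λ M → Removable k (complete n) M × size M ≡ m)
complete-not-guaranteed {k} m n 1≤m (inj₁ n≡k+1) (M , removable , size≡m)
  with trans n≡k+1 (+-comm k 1)
... | refl = no-removable-edge M removable (subst (1 ≤_) (sym size≡m) 1≤m)
complete-not-guaranteed (suc m) n _ (inj₂ refl) (M , _ , size≡m) =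
  -- Here `2 * suc m` computes to `suc n`.
  1+n≰n (subst (λ s → 2 * s ≤ n) size≡m (2size≤n (complete n) M))

-- Let D be the threshold. If d < D, then d is at most D - 1, a lower bound for the minimum degree
-- of the complete graph on D vertices, so the guarantee applies to it. As D is one of the two terms
-- of the maximum, `complete-not-guaranteed` refutes this.
threshold-minimal : ∀ k m → 1 ≤ m → ∀ d → Guarantees k m d → + ((k + 1) ⊔ (2 * m ∸ 1)) ℤ.≤ d
threshold-minimal k m 1≤m d guaranteed = by-size _ refl
  where
  k<D : k < (k + 1) ⊔ (2 * m ∸ 1)
  k<D = ≤-trans (≤-reflexive (+-comm 1 k)) (m≤m⊔n (k + 1) _)
  by-size : ∀ n → n ≡ (k + 1) ⊔ (2 * m ∸ 1) → + n ℤ.≤ d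
  by-size zero    n≡D = contradiction (subst (k <_) (sym n≡D) k<D) λ ()
  by-size (suc n) n≡D = ℤP.≮⇒≥ λ d<n → complete-not-guaranteed m (suc n) 1≤m
    (Sum.map (trans n≡D) (trans n≡D) (⊔-sel (k + 1) _))
    (guaranteed (complete (suc n)) (complete-kConnected k<n)
      (ℤP.≤-trans (ℤP.i<j⇒i≤pred[j] d<n) (+≤+ (δ-complete n))))
    where
    k<n : k < suc n
    k<n = subst (k <_) (sym n≡D) k<D

mainTheorem2 : (k m : ℕ) → k ≥ 1 → m ≥ 1 → IsLeast (Guarantees k m) (+ ((k + 1) ⊔ (2 * m ∸ 1)))
mainTheorem2 k m _ m≥1 = guarantees k m , threshold-minimal k m m≥1
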